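{- Let $k$ be a positive integer, let $\mathbb{F}$ be a field, let $G$ be an $n$-vertex graph, and let $A\in\mathcal{A}_\mathbb{F}(G)$. Let $p(x)\in\mathbb{F}_k[x]$ be a polynomial such that $(p(A))_{uu}\neq 0$ for each $u\in V(G)$. Then $$\alpha_k(G)\leq\Theta(G^k)\leq\mathrm{rank}_\mathbb{F}(p(A)).$$
   Context: Graphs are finite, simple, undirected, with nonempty vertex set $V(G)$ and edge set $E(G)$. A $k$-independent set of $G$ is a set of vertices any two distinct members of which are at distance greater than $k$ in $G$ (vertices in different components are at infinite distance); $\alpha_k(G)$ is the maximum size of a $k$-independent set, and $\alpha(H)$ is the usual independence number of a graph $H$. The power graph $G^k$ has the same vertices as $G$, two distinct vertices being adjacent iff they are at distance at most $k$ in $G$. $\mathcal{A}_\mathbb{F}(G)$ is the set of $|V(G)|\times|V(G)|$ matrices $A$ over $\mathbb{F}$ (not necessarily symmetric), indexed by the vertices of $G$, with $(A)_{ij}=0$ whenever $i\neq j$ and $\{i,j\}\notin E(G)$. $\mathbb{F}_k[x]$ is the set of polynomials over $\mathbb{F}$ of degree at most $k$. $\mathrm{rank}_\mathbb{F}$ denotes rank over $\mathbb{F}$. Shannon capacity: for a graph $H$ and an integer $t\ge 1$, $H^{\square t}$ is the graph with vertex set $V(H)^t$ in which two distinct vertices $u_1\cdots u_t$ and $v_1\cdots v_t$ are adjacent iff for each $i\in\{1,\ldots,t\}$ either $u_i=v_i$ or $\{u_i,v_i\}\in E(H)$. The Shannon capacity of $H$ is $\Theta(H)=\sup_{t\ge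 1}\alpha(H^{\square t})^{1/t}$. -}

module Defs where

open import Algebra.Apartness.Bundles using (HeytingField; HeytingCommutativeRing)
open import Algebra.Bundles using (CommutativeRing)
import Algebra.Definitions.RawSemiring as RawSemiringDefinitions
import Algebra.Properties.Semiring.Sum as SemiringSum
open import Data.Fin.Base using (Fin; toℕ; finToFun)
open import Data.Fin.Properties using (_≟_; all?; any?)
open import Data.Fin.Subset using (Subset; inside; outside; _∈_; ∣_∣)
open import Data.Fin.Subset.Properties using (_∈?_)
import Data.Integer.Base as ℤ
open import Data.List.Base as List using (List; filter; _++_)
open import Data.List.Extrema.Nat using (max)
open import Data.Nat.Base as ℕ using (ℕ; zero; suc)
import Data.Nat.Properties as ℕ
open import Data.Product.Base using (Σ; ∃; _×_; _,_; proj₁)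
open import Data.Rational.Base as ℚ using (ℚ; 0ℚ)
import Data.Rational.Properties as ℚ
open import Data.Sum.Base using (_⊎_; inj₁; inj₂)
open import Data.Vec.Base using ([]; _∷_)
open import Data.Vec.Functional using (Vector)
open import Function.Base using (_∘_)
open import Level using (0ℓ; _⊔_)
open import Relation.Binary.Core using (Rel)
open import Relation.Binary.Definitions using (Decidable; Symmetric)
open import Relation.Binary.PropositionalEquality using (_≡_; _≢_; refl; sym)
open import Relation.Nullary using (¬_; Dec; yes; no)
open import Relation.Nullary.Decidable
  using (map′; ¬?; _×-dec_; _⊎-dec_; _→-dec_)
import Relation.Unary as U

private
  variable
    n : ℕ

------------------------------------------------------------------------
-- Graphs

record Graph (n : ℕ) : Set₁ where
  field
    Adj    : Rel (Fin n) 0ℓ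
    adj?   : Decidable Adj
    symm   : Symmetric Adj
    irrefl : ∀ {u} → ¬ Adj u u

data Walk (G : Graph n) : ℕ → Rel (Fin n) 0ℓ where
  nil  : ∀ {u} → Walk G zero u u
  cons : ∀ {l u v w} → Graph.Adj G u v → Walk G l v w → Walk G (suc l) u w

-- The distance is the infimum in ℕ ∪ {∞} of the lengths of the walks from
-- u to v, so it is at most k iff some walk has length at most k.
Dist≤ : Graph n → ℕ → Rel (Fin n) 0ℓ
Dist≤ G k u v = ∃ λ l → l ℕ.≤ k × Walk G l u v

Dist> : Graph n → ℕ → Rel (Fin n) 0ℓ
Dist> G k u v = ¬ Dist≤ G k u v

walk? : (G : Graph n) → ∀ l → Decidable (Walk G l)
walk? G zero u v = map′ (λ { refl → nil }) (λ { nil → refl }) (u ≟ v)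
walk? G (suc l) u w =
  map′ (λ { (_ , a , p) → cons a p }) (λ { (cons a p) → _ , a , p })
       (any? λ v → Graph.adj? G u v ×-dec walk? G l v w)

dist≤? : (G : Graph n) → ∀ k → Decidable (Dist≤ G k)
dist≤? G k u v =
  map′ (λ (l , l<1+k , p) → l , ℕ.s≤s⁻¹ l<1+k , p)
       (λ (l , l≤k , p) → l , ℕ.s≤s l≤k , p)
       (ℕ.anyUpTo? (λ l → walk? G l u v) (suc k))

snoc : (G : Graph n) → ∀ {l u v w} →
       Walk G l u v → Graph.Adj G v w → Walk G (suc l) u w
snoc G nil        b = cons b nil
snoc G (cons a p) b = cons a (snoc G p b)

reverse : (G : Graph n) → ∀ {l} → Symmetric (Walk G l)
reverse G nil        = nil
reverse G (cons a p) = snoc G (reverse G p) (Graph.symm G a)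

infix 30 _^ᴳ_ _□^_

_^ᴳ_ : Graph n → ℕ → Graph n
G ^ᴳ k = record
  { Adj    = λ u v → u ≢ v × Dist≤ G k u v
  ; adj?   = λ u v → ¬? (u ≟ v) ×-dec dist≤? G k u v
  ; symm   = λ { (u≢v , l , l≤k , p) → u≢v ∘ sym , l , l≤k , reverse G p }
  ; irrefl = λ { (u≢u , _) → u≢u refl }
  }

-- Vertices of the t-th strong power are t-tuples of vertices, encoded in
-- Fin (n ^ t) via the bijection finToFun : Fin (n ^ t) → (Fin t → Fin n).
_□^_ : Graph n → (t : ℕ) → Graph (n ℕ.^ t)
_□^_ {n} H t = record
  { Adj    = λ u v → u ≢ v × (∀ i → Coord (tuple u i) (tuple v i))
  ; adj?   = λ u v → ¬? (u ≟ v) ×-dec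
                     all? λ i → (tuple u i ≟ tuple v i) ⊎-dec
                                adj? (tuple u i) (tuple v i)
  ; symm   = λ { (u≢v , f) → u≢v ∘ sym , λ i → flip (f i) }
  ; irrefl = λ { (u≢u , _) → u≢u refl }
  }
  where
  open Graph H

  tuple : Fin (n ℕ.^ t) → Fin t → Fin n
  tuple = finToFun

  Coord : Rel (Fin n) 0ℓ
  Coord a b = a ≡ b ⊎ Adj a b

  flip : Symmetric Coord
  flip (inj₁ a≡b) = inj₁ (sym a≡b)
  flip (inj₂ a~b) = inj₂ (symm a~b)

------------------------------------------------------------------------
-- Independence numbers

Pairwise : Rel (Fin n) 0ℓ → U.Pred (Subset n) 0ℓ
Pairwise R S = ∀ u v → u ∈ S → v ∈ S → u ≢ v → R u v

pairwise? : {R : Rel (Fin n) 0ℓ} → Decidable R → U.Decidable (Pairwise R)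
pairwise? R? S =
  all? λ u → all? λ v →
    (u ∈? S) →-dec (v ∈? S) →-dec ¬? (u ≟ v) →-dec R? u v

subsets : ∀ n → List (Subset n)
subsets zero    = List.[ [] ]
subsets (suc n) =
  List.map (outside ∷_) (subsets n) ++ List.map (inside ∷_) (subsets n)

-- The default 0 is harmless: it is used on families containing ∅.
maxSize : {P : U.Pred (Subset n) 0ℓ} → U.Decidable P → ℕ
maxSize {n} P? = max 0 (List.map ∣_∣ (filter P? (subsets n)))

IsIndependent : Graph n → U.Pred (Subset n) 0ℓ
IsIndependent H = Pairwise λ u v → ¬ Graph.Adj H u v

isIndependent? : (H : Graph n) → U.Decidable (IsIndependent H)
isIndependent? H = pairwise? λ u v → ¬? (Graph.adj? H u v)

α : Graph n → ℕ
α H = maxSize (isIndependent? H)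

Is_-Independent : ℕ → Graph n → U.Pred (Subset n) 0ℓ
Is k -Independent G = Pairwise (Dist> G k)

is_-independent? : ∀ k (G : Graph n) → U.Decidable (Is k -Independent G)
is k -independent? G = pairwise? λ u v → ¬? (dist≤? G k u v)

α[_] : ℕ → Graph n → ℕ
α[ k ] G = maxSize (is k -independent? G)

------------------------------------------------------------------------
-- Extended reals as lower Dedekind cuts

-- x is represented by {q ∈ ℚ : q < x}. The empty cut is -∞ and the full
-- cut is +∞, so every family has a supremum.
record ℝ∞ : Set₁ where
  field
    _∋_     : U.Pred ℚ 0ℓ
    lower   : ∀ {p q} → p ℚ.< q → _∋_ q → _∋_ p
    rounded : ∀ {p} → _∋_ p → ∃ λ q → p ℚ.< q × _∋_ q

open ℝ∞ public using (_∋_)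

infix 4 _≤ℝ_

_≤ℝ_ : Rel ℝ∞ 0ℓ
x ≤ℝ y = ∀ q → x ∋ q → y ∋ q

fromℚ : ℚ → ℝ∞
fromℚ r = record
  { _∋_     = ℚ._< r
  ; lower   = ℚ.<-trans
  ; rounded = λ p<r → let q , p<q , q<r = ℚ.<-dense p<r in q , p<q , q<r
  }

fromℕ : ℕ → ℝ∞
fromℕ a = fromℚ (ℤ.+ a ℚ./ 1)

sup : {I : Set} → (I → ℝ∞) → ℝ∞
sup x = record
  { _∋_     = λ q → ∃ λ i → x i ∋ q
  ; lower   = λ { p<q (i , q∈) → i , ℝ∞.lower (x i) p<q q∈ }
  ; rounded = λ { (i , p∈) → let q , p<q , q∈ = ℝ∞.rounded (x i) p∈
                             in q , p<q , i , q∈ }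
  }

open RawSemiringDefinitions ℚ.+-*-rawSemiring public using () renaming (_^_ to _^ℚ_)

-- For t ≥ 1, the t-th root of a is sup {s ∈ ℚ : 0 ≤ s, s ^ t ≤ a}.
root : ℕ → ℕ → ℝ∞
root t a =
  sup {Σ ℚ λ s → 0ℚ ℚ.≤ s × s ^ℚ t ℚ.≤ ℤ.+ a ℚ./ 1} λ (s , _) → fromℚ s

Θ : Graph n → ℝ∞
Θ H = sup λ ((t , _) : ∃ λ t → t ℕ.≥ 1) → root t (α (H □^ t))

------------------------------------------------------------------------
-- Linear algebra over a field

-- In a HeytingField every x # 0# is invertible, 1# # 0#, and # is tight.
-- Classically x # y is x ≉ y, and this is exactly a field.
module LinearAlgebra {c ℓ₁ ℓ₂} (F : HeytingField c ℓ₁ ℓ₂) where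

  open HeytingField F
  open CommutativeRing (HeytingCommutativeRing.commutativeRing heytingCommutativeRing)
    using (semiring)
  open SemiringSum semiring using (sum)

  Matrix : ℕ → Set c
  Matrix n = Fin n → Fin n → Carrier

  1ᴹ : Matrix n
  1ᴹ i j with i ≟ j
  ... | yes _ = 1#
  ... | no  _ = 0#

  infixl 7 _*ᴹ_
  infixr 8 _^ᴹ_

  _*ᴹ_ : Matrix n → Matrix n → Matrix n
  (A *ᴹ B) i j = sum λ l → A i l * B l j

  _^ᴹ_ : Matrix n → ℕ → Matrix n
  A ^ᴹ zero  = 1ᴹ
  A ^ᴹ suc m = A *ᴹ A ^ᴹ m

  infix 4 _∈𝒜_

  _∈𝒜_ : Matrix n → Graph n → Set ℓ₁
  A ∈𝒜 G = ∀ i j → i ≢ j → ¬ Graph.Adj G i j → A i j ≈ 0#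

  -- Coefficients of 1, x, …, xᵏ; the leading one may vanish.
  Poly≤ : ℕ → Set c
  Poly≤ k = Vector Carrier (suc k)

  _⟦_⟧ : ∀ {k} → Poly≤ k → Matrix n → Matrix n
  (p ⟦ A ⟧) u v = sum λ m → p m * (A ^ᴹ toℕ m) u v

  LinearlyIndependent : ∀ {m} → Vector (Vector Carrier n) m → Set (c ⊔ ℓ₁)
  LinearlyIndependent {m = m} v =
    (a : Vector Carrier m) →
    (∀ i → sum (λ j → a j * v j i) ≈ 0#) → ∀ j → a j ≈ 0#

  columns : ∀ {m} → Matrix n → (Fin m → Fin n) → Vector (Vector Carrier n) m
  columns M f j i = M i (f j)

  -- r is the largest number of linearly independent columns of M. This is
  -- a relation because _≈_ is not assumed decidable. Independence of the
  -- family columns M f forces f to be injective.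
  Rank : Matrix n → ℕ → Set (c ⊔ ℓ₁)
  Rank {n} M r =
    (∃ λ (f : Fin r → Fin n) → LinearlyIndependent (columns M f)) ×
    (∀ {m} (f : Fin m → Fin n) → LinearlyIndependent (columns M f) → m ℕ.≤ r)

{-# OPTIONS --safe #-}
module Submission where

-- The matrix M = p(A) vanishes at pairs of distinct non-adjacent vertices of
-- Gᵏ and is nonzero on the diagonal. If M has rank r, then M = BC through dimension r,
-- and the t-th Kronecker power of M factors through dimension rᵗ. Its
-- restriction to an independent set of the t-th strong power of Gᵏ is a
-- diagonal matrix with nonzero diagonal, so such a set has at most rᵗ elements.
-- Equality in the field is not decidable, but the inequalities to be shown
-- are, so classical case distinctions are made under a double negation.

open import Defs
open import Algebra.Apartness.Bundles using (HeytingField; HeytingCommutativeRing)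
open import Algebra.Bundles using (CommutativeRing; Semiring)
import Algebra.Apartness.Properties.HeytingCommutativeRing as HeytingProperties
import Algebra.Definitions.RawSemiring as RawSemiringDefinitions
import Algebra.Properties.CommutativeSemigroup as CommutativeSemigroupProperties
import Algebra.Properties.Ring as RingProperties
import Algebra.Properties.Semiring.Sum as SemiringSum
open import Data.Fin.Base
  using (Fin; zero; suc; toℕ; cast; combine; finToFun; punchIn; quotient; remainder; splitAt)
open import Data.Fin.Properties
  using (_≟_; sequence; ¬∀⟶∃¬; punchInᵢ≢i; suc-injective; toℕ≤pred[n]; toℕ-injective;
         toℕ-cast; toℕ-combine; combine-remQuot; cast-is-id)
open import Data.Fin.Subset using (Subset; inside; outside; _∈_; ∣_∣)
import Data.Integer.Base as ℤ
import Data.Integer.Properties as ℤ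
open import Data.List.Base as List using (filter)
import Data.List.Relation.Unary.All as All
open import Data.List.Extrema.Nat using (max≤v⁺; xs≤max)
open import Data.List.Membership.Propositional using () renaming (_∈_ to _∈ˡ_)
open import Data.List.Membership.Propositional.Properties
  using (∈-++⁺ˡ; ∈-++⁺ʳ; ∈-map⁺; ∈-map∘filter⁺; ∈-map∘filter⁻)
open import Data.List.Relation.Unary.Any using (here)
open import Data.Nat.Base as ℕ using (ℕ; zero; suc; NonZero; z≤n; s≤s)
import Data.Nat.Coprimality as Coprimality
import Data.Nat.Properties as ℕ
open import Data.Product.Base using (∃; _×_; _,_; proj₁; proj₂)
open import Data.Rational.Base as ℚ using (ℚ; 0ℚ; 1ℚ)
import Data.Rational.Properties as ℚ
open import Data.Sum.Base using (_⊎_; inj₁; inj₂; [_,_]′)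
open import Data.Vec.Base as Vec using ([]; _∷_)
open import Data.Vec.Functional as Vector using (Vector; insertAt; tail)
import Data.Vec.Functional.Properties as Vector
open import Effect.Monad using (RawMonad)
open import Function.Base using (_∘_; const)
open import Relation.Binary.PropositionalEquality as ≡ using (_≡_; _≢_)
import Relation.Binary.Reasoning.Setoid as SetoidReasoning
open import Relation.Nullary using (¬_; yes; no; contradiction)
open import Relation.Nullary.Decidable using (decidable-stable; _⊎-dec_)
open import Relation.Nullary.Negation using (¬¬-map; ¬¬-Monad)
open import Relation.Unary using (Pred; Decidable)
open import Level using (0ℓ; _⊔_)

private
  variable
    m n : ℕ

-- Subsets of maximal size

∈-subsets : (S : Subset n) → S ∈ˡ subsets n
∈-subsets []            = here ≡.refl
∈-subsets (outside ∷ S) = ∈-++⁺ˡ (∈-map⁺ (outside ∷_) (∈-subsets S))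
∈-subsets (inside ∷ S)  = ∈-++⁺ʳ _ (∈-map⁺ (inside ∷_) (∈-subsets S))

module _ {P : Pred (Subset n) 0ℓ} (P? : Decidable P) where

  ∣S∣≤maxSize : ∀ S → P S → ∣ S ∣ ℕ.≤ maxSize P?
  ∣S∣≤maxSize S pS =
    All.lookup (xs≤max 0 _) (∈-map∘filter⁺ ∣_∣ P? (S , ∈-subsets S , ≡.refl , pS))

  maxSize-least : ∀ {b} → (∀ S → P S → ∣ S ∣ ℕ.≤ b) → maxSize P? ℕ.≤ b
  maxSize-least bound = max≤v⁺ {xs = List.map ∣_∣ (filter P? (subsets n))} z≤n (All.tabulate λ x∈ →
    let S , _ , x≡∣S∣ , pS = ∈-map∘filter⁻ ∣_∣ P? {xs = subsets n} x∈
    in ≡.subst (ℕ._≤ _) (≡.sym x≡∣S∣) (bound S pS))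

enumerate : (S : Subset n) → Fin ∣ S ∣ → Fin n
enumerate (outside ∷ S) i       = suc (enumerate S i)
enumerate (inside ∷ S)  zero    = zero
enumerate (inside ∷ S)  (suc i) = suc (enumerate S i)

enumerate-∈ : (S : Subset n) → ∀ i → enumerate S i ∈ S
enumerate-∈ (outside ∷ S) i       = Vec.there (enumerate-∈ S i)
enumerate-∈ (inside ∷ S)  zero    = Vec.here
enumerate-∈ (inside ∷ S)  (suc i) = Vec.there (enumerate-∈ S i)

enumerate-injective : (S : Subset n) → ∀ {i j} → enumerate S i ≡ enumerate S j → i ≡ j
enumerate-injective (outside ∷ S)                eq = enumerate-injective S (suc-injective eq)
enumerate-injective (inside ∷ S) {zero}  {zero}  eq = ≡.refl
enumerate-injective (inside ∷ S) {suc i} {suc j} eq =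
  ≡.cong suc (enumerate-injective S (suc-injective eq))

-- Rational powers

fromℕℚ : ℕ → ℚ
fromℕℚ a = ℤ.+ a ℚ./ 1

-- Division normalizes by a gcd and is stuck on a variable; the explicit form lets order and product
-- compute.
fromℕℚ≡mkℚ : ∀ a → fromℕℚ a ≡ ℚ.mkℚ (ℤ.+ a) 0 (Coprimality.sym (Coprimality.1-coprimeTo a))
fromℕℚ≡mkℚ a = ℚ.normalize-coprime _

fromℕℚ-mono : ∀ {a b} → a ℕ.≤ b → fromℕℚ a ℚ.≤ fromℕℚ b
fromℕℚ-mono {a} {b} a≤b rewrite fromℕℚ≡mkℚ a | fromℕℚ≡mkℚ b =
  ℚ.*≤* (ℤ.*-monoʳ-≤-nonNeg ℤ.1ℤ (ℤ.+≤+ a≤b))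

fromℕℚ-* : ∀ a b → fromℕℚ (a ℕ.* b) ≡ fromℕℚ a ℚ.* fromℕℚ b
fromℕℚ-* a b = ≡.trans (≡.cong (ℚ._/ 1) (ℤ.pos-* a b))
  (≡.cong₂ ℚ._*_ (≡.sym (fromℕℚ≡mkℚ a)) (≡.sym (fromℕℚ≡mkℚ b)))

fromℕℚ-^ : ∀ a t → fromℕℚ (a ℕ.^ t) ≡ fromℕℚ a ^ℚ t
fromℕℚ-^ a zero    = ≡.refl
fromℕℚ-^ a (suc t) = ≡.trans (fromℕℚ-* a (a ℕ.^ t)) (≡.cong (fromℕℚ a ℚ.*_) (fromℕℚ-^ a t))

^ℚ-nonNeg : ∀ {x} → 0ℚ ℚ.≤ x → ∀ t → 0ℚ ℚ.≤ x ^ℚ t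
^ℚ-nonNeg {x} 0≤x zero    = ℚ.nonNegative⁻¹ 1ℚ
^ℚ-nonNeg {x} 0≤x (suc t) = ≡.subst (ℚ._≤ x ℚ.* x ^ℚ t) (ℚ.*-zeroʳ x)
  (ℚ.*-monoˡ-≤-nonNeg x {{ℚ.nonNegative 0≤x}} (^ℚ-nonNeg 0≤x t))

^ℚ-monoˡ-≤ : ∀ {x y} → 0ℚ ℚ.≤ x → x ℚ.≤ y → ∀ t → x ^ℚ t ℚ.≤ y ^ℚ t
^ℚ-monoˡ-≤ _ _ zero = ℚ.≤-refl
^ℚ-monoˡ-≤ {x} {y} 0≤x x≤y (suc t) = ℚ.≤-trans
  (ℚ.*-monoˡ-≤-nonNeg x {{ℚ.nonNegative 0≤x}} (^ℚ-monoˡ-≤ 0≤x x≤y t))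
  (ℚ.*-monoʳ-≤-nonNeg (y ^ℚ t) {{ℚ.nonNegative (^ℚ-nonNeg (ℚ.≤-trans 0≤x x≤y) t)}} x≤y)

^ℚ-monoˡ-< : ∀ {x y} → 0ℚ ℚ.≤ x → x ℚ.< y → ∀ t → t ℕ.≥ 1 → x ^ℚ t ℚ.< y ^ℚ t
^ℚ-monoˡ-< {x} {y} 0≤x x<y 1 _ =
  ≡.subst₂ ℚ._<_ (≡.sym (ℚ.*-identityʳ x)) (≡.sym (ℚ.*-identityʳ y)) x<y
-- The factor `x ^ℚ t` may be 0, so replacing `x` by `y` is only weakly monotone. Strictness comes
-- from the second step, where `y` is positive.
^ℚ-monoˡ-< {x} {y} 0≤x x<y (suc t@(suc _)) _ = ℚ.≤-<-trans
  (ℚ.*-monoʳ-≤-nonNeg (x ^ℚ t) {{ℚ.nonNegative (^ℚ-nonNeg 0≤x t)}} (ℚ.<⇒≤ x<y))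
  (ℚ.*-monoʳ-<-pos y {{ℚ.positive (ℚ.≤-<-trans 0≤x x<y)}} (^ℚ-monoˡ-< 0≤x x<y t (s≤s z≤n)))

fromℕℚ-nonNeg : ∀ a → 0ℚ ℚ.≤ fromℕℚ a
fromℕℚ-nonNeg a = fromℕℚ-mono {0} {a} z≤n

root-≤ : ∀ {a r} t → t ℕ.≥ 1 → a ℕ.≤ r ℕ.^ t → root t a ≤ℝ fromℕ r
root-≤ {a} {r} t t≥1 a≤rᵗ q ((s , 0≤s , sᵗ≤a) , q<s) with s ℚ.≤? fromℕℚ r
... | yes s≤r = ℚ.<-≤-trans q<s s≤r
... | no  s≰r = contradiction
  (ℚ.<-≤-trans (^ℚ-monoˡ-< (fromℕℚ-nonNeg r) (ℚ.≰⇒> s≰r) t t≥1)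
    (ℚ.≤-trans sᵗ≤a (≡.subst (fromℕℚ a ℚ.≤_) (fromℕℚ-^ r t) (fromℕℚ-mono a≤rᵗ))))
  (ℚ.<-irrefl ≡.refl)

fromℕ≤root-1 : ∀ {a b} → a ℕ.≤ b → fromℕ a ≤ℝ root 1 b
fromℕ≤root-1 {a} a≤b q q<a =
  -- The number `a` is itself an admissible first root of `b`.
  (fromℕℚ a , fromℕℚ-nonNeg a ,
   ≡.subst (ℚ._≤ _) (≡.sym (ℚ.*-identityʳ _)) (fromℕℚ-mono a≤b)) , q<a

-- The strong power with exponent 1

-- Since `n ^ 1` unfolds to `n * 1`, a vertex is a quotient paired with a remainder in `Fin 1`, and
-- that remainder is zero.
finToFun-1 : (u : Fin (n ℕ.^ 1)) → finToFun {n} {1} u zero ≡ cast (ℕ.*-identityʳ n) u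
finToFun-1 {n = n} u = toℕ-injective (begin
  toℕ q                            ≡⟨ ℕ.*-identityˡ _ ⟨
  1 ℕ.* toℕ q                      ≡⟨ ℕ.+-identityʳ _ ⟨
  1 ℕ.* toℕ q ℕ.+ 0                ≡⟨ ≡.cong (1 ℕ.* toℕ q ℕ.+_) (toℕ-Fin1 ρ) ⟨
  1 ℕ.* toℕ q ℕ.+ toℕ ρ            ≡⟨ toℕ-combine q ρ ⟨
  toℕ (combine q ρ)                ≡⟨ ≡.cong toℕ (combine-remQuot {n} 1 u) ⟩
  toℕ u                            ≡⟨ toℕ-cast _ u ⟨
  toℕ (cast (ℕ.*-identityʳ n) u)   ∎)
  where
  open ≡.≡-Reasoning
  q = quotient {n} 1 u
  ρ = remainder {n} 1 u
  toℕ-Fin1 : (i : Fin 1) → toℕ i ≡ 0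
  toℕ-Fin1 zero = ≡.refl

-- Removing edges keeps a set independent. With `m` and `n` both variables, `eq` can be matched with
-- `refl`.
α-cast : (eq : m ≡ n) (H : Graph n) (K : Graph m) →
         (∀ {u v} → Graph.Adj K u v → Graph.Adj H (cast eq u) (cast eq v)) → α H ℕ.≤ α K
α-cast ≡.refl H K K⇒H = maxSize-least (isIndependent? H) λ S ind →
  ∣S∣≤maxSize (isIndependent? K) S λ u v u∈S v∈S u≢v adj →
    ind u v u∈S v∈S u≢v
      (≡.subst₂ (Graph.Adj H) (cast-is-id ≡.refl u) (cast-is-id ≡.refl v) (K⇒H adj))

α≤α-□^1 : (H : Graph n) → α H ℕ.≤ α (H □^ 1)
α≤α-□^1 {n} H = α-cast (ℕ.*-identityʳ n) H (H □^ 1) adj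
  where
  adj : ∀ {u v} → Graph.Adj (H □^ 1) u v →
        Graph.Adj H (cast (ℕ.*-identityʳ n) u) (cast (ℕ.*-identityʳ n) v)
  adj {u} {v} (u≢v , coord) with coord zero
  ... | inj₂ u~v = ≡.subst₂ (Graph.Adj H) (finToFun-1 {n} u) (finToFun-1 {n} v) u~v
  ... | inj₁ u≡v = contradiction (toℕ-injective (begin
    toℕ u             ≡⟨ toℕ-cast _ u ⟨
    toℕ (cast _ u)    ≡⟨ ≡.cong toℕ (finToFun-1 {n} u) ⟨
    toℕ (finToFun {n} {1} u zero) ≡⟨ ≡.cong toℕ u≡v ⟩
    toℕ (finToFun {n} {1} v zero) ≡⟨ ≡.cong toℕ (finToFun-1 {n} v) ⟩
    toℕ (cast _ v)    ≡⟨ toℕ-cast _ v ⟩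
    toℕ v             ∎)) u≢v
    where open ≡.≡-Reasoning

-- Independence numbers and the Shannon capacity

α[k]≤α-^ᴳ : ∀ k (G : Graph n) → α[ k ] G ℕ.≤ α (G ^ᴳ k)
α[k]≤α-^ᴳ k G = maxSize-least (is k -independent? G) λ S ind →
  ∣S∣≤maxSize (isIndependent? (G ^ᴳ k)) S λ u v u∈S v∈S u≢v (_ , near) →
    ind u v u∈S v∈S u≢v near

α≤Θ : (H : Graph n) → ∀ {a} → a ℕ.≤ α H → fromℕ a ≤ℝ Θ H
α≤Θ H a≤α q q<a = (1 , s≤s z≤n) , fromℕ≤root-1 (ℕ.≤-trans a≤α (α≤α-□^1 H)) q q<a

Θ-least : (H : Graph n) → ∀ {r} → (∀ t → α (H □^ t) ℕ.≤ r ℕ.^ t) → Θ H ≤ℝ fromℕ r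
Θ-least H bound q ((t , t≥1) , q∈) = root-≤ t t≥1 (bound t) q q∈

-- Being equal or adjacent is decidable at each of finitely many coordinates, so the failure of
-- adjacency yields an explicit bad coordinate.
independent-□^-separated : (H : Graph n) → ∀ t {S} → IsIndependent (H □^ t) S →
  ∀ {u v} → u ∈ S → v ∈ S → u ≢ v →
  ∃ λ i → finToFun {n} {t} u i ≢ finToFun v i × ¬ Graph.Adj H (finToFun u i) (finToFun v i)
independent-□^-separated {n} H t ind {u} {v} u∈S v∈S u≢v =
  let i , far = ¬∀⟶∃¬ t _ (λ i → (tuple u i ≟ tuple v i) ⊎-dec Graph.adj? H (tuple u i) (tuple v i))
                  (λ near → ind u v u∈S v∈S u≢v (u≢v , near))
  in i , far ∘ inj₁ , far ∘ inj₂
  where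
  tuple : Fin (n ℕ.^ t) → Fin t → Fin n
  tuple = finToFun

-- Linear algebra over a Heyting field

module FieldLinearAlgebra {c ℓ₁ ℓ₂} (F : HeytingField c ℓ₁ ℓ₂) where

  open HeytingField F hiding (zero)
  open LinearAlgebra F
  open CommutativeRing (HeytingCommutativeRing.commutativeRing heytingCommutativeRing)
    using (semiring; ring; *-commutativeSemigroup)
  open HeytingProperties heytingCommutativeRing using (1#0; x-0≈x)
  open SemiringSum semiring
  open RingProperties ring using (-‿distribˡ-*; -‿distribʳ-*; +-inverseˡ-unique)
  open CommutativeSemigroupProperties *-commutativeSemigroup using (interchange)
  open RawSemiringDefinitions (Semiring.rawSemiring semiring) using (product)
  open SetoidReasoning setoid

  #0-tight : ∀ {x} → ¬ (x # 0#) → x ≈ 0#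
  #0-tight = proj₁ (tight _ _)

  #0⇒≉0 : ∀ {x} → x # 0# → ¬ (x ≈ 0#)
  #0⇒≉0 x#0 x≈0 = proj₂ (tight _ _) x≈0 x#0

  #0⇒inverse : ∀ {x} → x # 0# → ∃ λ y → y * x ≈ 1#
  #0⇒inverse x#0 =
    let y , y*[x-0]≈1 , _ = #⇒invertible x#0
    in y , trans (*-congˡ (sym (x-0≈x _))) y*[x-0]≈1

  -- If `x # 0#`, cancelling `x` gives `y ≈ 0#`; tightness turns this refutation into `x ≈ 0#`. A
  -- mere inequality for `y` suffices, as in the hypothesis on the diagonal.
  x*y≈0∧y≉0⇒x≈0 : ∀ {x y} → x * y ≈ 0# → ¬ (y ≈ 0#) → x ≈ 0#
  x*y≈0∧y≉0⇒x≈0 {x} {y} xy≈0 y≉0 = #0-tight λ x#0 →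
    let z , zx≈1 = #0⇒inverse x#0 in y≉0 (begin
      y            ≈⟨ *-identityˡ y ⟨
      1# * y       ≈⟨ *-congʳ zx≈1 ⟨
      z * x * y    ≈⟨ *-assoc z x y ⟩
      z * (x * y)  ≈⟨ *-congˡ xy≈0 ⟩
      z * 0#       ≈⟨ zeroʳ z ⟩
      0#           ∎)

  -- Finite sums and products

  sum-≈0 : ∀ {n} (f : Vector Carrier n) → (∀ i → f i ≈ 0#) → sum f ≈ 0#
  sum-≈0 {n} f f≈0 = trans (sum-cong-≋ f≈0) (sum-replicate-zero n)

  sum-supported : ∀ {n} (f : Vector Carrier n) i → (∀ j → j ≢ i → f j ≈ 0#) → sum f ≈ f i
  sum-supported {suc n} f i f≈0 = begin
    sum f                           ≈⟨ sum-remove {i = i} f ⟩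
    f i + sum (Vector.removeAt f i) ≈⟨ +-congˡ (sum-≈0 _ λ j → f≈0 _ (punchInᵢ≢i i j)) ⟩
    f i + 0#                        ≈⟨ +-identityʳ _ ⟩
    f i                             ∎

  sum-++ : ∀ {m n} (f : Vector Carrier m) (g : Vector Carrier n) →
           sum (f Vector.++ g) ≈ sum f + sum g
  sum-++ {zero}  f g = sym (+-identityˡ _)
  sum-++ {suc m} f g = begin
    f zero + sum (tail (f Vector.++ g))  ≡⟨ ≡.cong (f zero +_) (sum-cong-≗ tail-++) ⟩
    f zero + sum (tail f Vector.++ g)    ≈⟨ +-congˡ (sum-++ (tail f) g) ⟩
    f zero + (sum (tail f) + sum g)      ≈⟨ +-assoc _ _ _ ⟨
    sum f + sum g                        ∎
    where
    tail-++ : ∀ i → tail (f Vector.++ g) i ≡ (tail f Vector.++ g) i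
    tail-++ i with splitAt m i
    ... | inj₁ _ = ≡.refl
    ... | inj₂ _ = ≡.refl

  sum-concat : ∀ {m n} (f : Vector (Vector Carrier n) m) →
               sum (Vector.concat f) ≈ sum (sum ∘ f)
  sum-concat {zero}  f = refl
  sum-concat {suc m} {n} f = begin
    sum (Vector.concat f)                          ≡⟨ sum-cong-≗ concat-∷ ⟩
    sum (f zero Vector.++ Vector.concat (tail f))  ≈⟨ sum-++ (f zero) (Vector.concat (tail f)) ⟩
    sum (f zero) + sum (Vector.concat (tail f))    ≈⟨ +-congˡ (sum-concat (tail f)) ⟩
    sum (sum ∘ f)                                  ∎
    where
    concat-∷ : ∀ i → Vector.concat f i ≡ (f zero Vector.++ Vector.concat (tail f)) i
    concat-∷ i with splitAt n i
    ... | inj₁ _ = ≡.refl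
    ... | inj₂ _ = ≡.refl

  -- The expanded product is indexed by `Fin (m * n)`; this is how inner dimensions come to
  -- multiply.
  sum-*-sum : ∀ {m n} (f : Vector Carrier m) (g : Vector Carrier n) →
              sum f * sum g ≈ sum (Vector.concat λ i j → f i * g j)
  sum-*-sum f g = begin
    sum f * sum g                        ≈⟨ *-distribʳ-sum (sum g) f ⟩
    sum (λ i → f i * sum g)              ≈⟨ sum-cong-≋ (λ i → *-distribˡ-sum (f i) g) ⟩
    sum (λ i → sum λ j → f i * g j)      ≈⟨ sum-concat (λ i j → f i * g j) ⟨
    sum (Vector.concat λ i j → f i * g j) ∎

  product-≈0 : ∀ {n} (f : Vector Carrier n) i → f i ≈ 0# → product f ≈ 0#
  product-≈0 f zero    f≈0 = trans (*-congʳ f≈0) (zeroˡ _)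
  product-≈0 f (suc i) f≈0 = trans (*-congˡ (product-≈0 (tail f) i f≈0)) (zeroʳ _)

  product-≉0 : ∀ {n} (f : Vector Carrier n) → (∀ i → ¬ (f i ≈ 0#)) → ¬ (product f ≈ 0#)
  product-≉0 {zero}  f f≉0 1≈0 = #0⇒≉0 1#0 1≈0
  product-≉0 {suc n} f f≉0 Πf≈0 =
    f≉0 zero (x*y≈0∧y≉0⇒x≈0 Πf≈0 (product-≉0 (tail f) (f≉0 ∘ suc)))

  -- Gaussian elimination of the first coordinate.
  linearlyIndependent⇒≤ : ∀ {n m} (v : Vector (Vector Carrier n) m) →
                          LinearlyIndependent v → m ℕ.≤ n
  linearlyIndependent⇒≤ {n}     {zero}  v li = z≤n
  linearlyIndependent⇒≤ {zero}  {suc m} v li =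
    contradiction (li (const 1#) (λ ()) zero) (#0⇒≉0 1#0)
  linearlyIndependent⇒≤ {suc n} {suc m} v li =
    decidable-stable (_ ℕ.≤? _) (¬¬-map [ no-pivot , pivot ]′ search)
    where
    -- Whether a pivot exists is undecidable, but the double negation is harmless because `_≤_` on
    -- naturals is decidable.
    search : ¬ ¬ ((∀ i → v i zero ≈ 0#) ⊎ (∃ λ i → v i zero # 0#))
    search ¬found = ¬found (inj₁ λ i → #0-tight λ vᵢ#0 → ¬found (inj₂ (i , vᵢ#0)))

    no-pivot : (∀ i → v i zero ≈ 0#) → suc m ℕ.≤ suc n
    no-pivot v₀≈0 = ℕ.m≤n⇒m≤1+n (linearlyIndependent⇒≤ (tail ∘ v) λ a rel → li a λ where
      zero    → sum-≈0 (λ j → a j * v j zero) λ j → trans (*-congˡ (v₀≈0 j)) (zeroʳ _)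
      (suc k) → rel k)

    pivot : (∃ λ i → v i zero # 0#) → suc m ℕ.≤ suc n
    pivot (i , vᵢ#0) = s≤s (linearlyIndependent⇒≤ (tail ∘ w) li′)
      where
      x = proj₁ (#0⇒inverse vᵢ#0)
      y : Vector (Vector Carrier (suc n)) m
      y j = v (punchIn i j)
      s : Vector Carrier m
      -- With `x` the inverse of the pivot entry, adding this multiple of `v i` clears the first
      -- coordinate of `y j`.
      s j = - (y j zero * x)
      w : Vector (Vector Carrier (suc n)) m
      w j k = y j k + s j * v i k

      w₀≈0 : ∀ j → w j zero ≈ 0#
      w₀≈0 j = begin
        y j zero + - (y j zero * x) * v i zero    ≈⟨ +-congˡ (-‿distribˡ-* _ _) ⟨
        y j zero + - (y j zero * x * v i zero)    ≈⟨ +-congˡ (-‿cong (*-assoc _ _ _)) ⟩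
        y j zero + - (y j zero * (x * v i zero))
          ≈⟨ +-congˡ (-‿cong (*-congˡ (proj₂ (#0⇒inverse vᵢ#0)))) ⟩
        y j zero + - (y j zero * 1#)              ≈⟨ +-congˡ (-‿cong (*-identityʳ _)) ⟩
        y j zero + - y j zero                     ≈⟨ -‿inverseʳ _ ⟩
        0#                                        ∎

      li′ : LinearlyIndependent (tail ∘ w)
      li′ a rel j = trans (reflexive (≡.sym (Vector.insertAt-punchIn a i _ j)))
                          (li b relᵇ (punchIn i j))
        where
        -- A relation among the reduced vectors becomes one among the original vectors once the
        -- multiples of `v i` are collected into its coefficient.
        bᵢ = sum λ j → a j * s j
        b  = insertAt a i bᵢ

        relʷ : ∀ k → sum (λ j → a j * w j k) ≈ 0#
        relʷ zero    = sum-≈0 _ λ j → trans (*-congˡ (w₀≈0 j)) (zeroʳ _)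
        relʷ (suc k) = rel k

        relᵇ : ∀ k → sum (λ j → b j * v j k) ≈ 0#
        relᵇ k = begin
          sum (λ j → b j * v j k)
            ≈⟨ sum-remove {i = i} (λ j → b j * v j k) ⟩
          b i * v i k + sum (λ j → b (punchIn i j) * y j k)
            ≈⟨ +-cong (*-congʳ (reflexive (Vector.insertAt-lookup a i bᵢ)))
                 (sum-cong-≋ λ j → *-congʳ (reflexive (Vector.insertAt-punchIn a i bᵢ j))) ⟩
          bᵢ * v i k + sum (λ j → a j * y j k)
            ≈⟨ +-comm _ _ ⟩
          sum (λ j → a j * y j k) + bᵢ * v i k
            ≈⟨ +-congˡ (*-distribʳ-sum (v i k) (λ j → a j * s j)) ⟩
          sum (λ j → a j * y j k) + sum (λ j → a j * s j * v i k)
            ≈⟨ ∑-distrib-+ (λ j → a j * y j k) _ ⟨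
          sum (λ j → a j * y j k + a j * s j * v i k)
            ≈⟨ sum-cong-≋ (λ (j : Fin m) → trans (+-congˡ (*-assoc (a j) _ _)) (sym (distribˡ _ _ _))) ⟩
          sum (λ j → a j * w j k)
            ≈⟨ relʷ k ⟩
          0# ∎

  -- Factorizations and rank

  FactorsThrough : ∀ {m n} → ℕ → (Fin m → Fin n → Carrier) → Set (c ⊔ ℓ₁)
  FactorsThrough {m} {n} r M =
    ∃ λ (P : Fin m → Fin r → Carrier) → ∃ λ (Q : Fin r → Fin n → Carrier) →
    ∀ i j → M i j ≈ sum λ l → P i l * Q l j

  -- The factors are the `r` chosen columns and the coordinates of every column in terms of them. A
  -- column outside their span would give `suc r` independent columns, against maximality.
  rank⇒factors : ∀ {n} (M : Matrix n) {r} → Rank M r → ¬ ¬ FactorsThrough r M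
  rank⇒factors {n} M {r} ((f , li) , maximal) = ¬¬-map
    (λ spans → (λ i l → M i (f l)) , (λ l j → proj₁ (spans j) l) , λ i j → proj₂ (spans j) i)
    -- Double negation commutes with the quantifier over finitely many columns.
    (sequence (RawMonad.rawApplicative ¬¬-Monad) span)
    where
    span : ∀ j → ¬ ¬ ∃ λ (q : Vector Carrier r) → ∀ i → M i j ≈ sum λ l → M i (f l) * q l
    span j ¬q = ℕ.1+n≰n (maximal (j Vector.∷ f) extended)
      where
      extended : LinearlyIndependent (columns M (j Vector.∷ f))
      extended a rel = coeffs
        where
        a₀≈0 : a zero ≈ 0#
        a₀≈0 = #0-tight λ a₀#0 →
          -- Dividing the relation by `a zero` would express column `j` through the chosen ones.
          let x , xa₀≈1 = #0⇒inverse a₀#0 in ¬q ((λ l → - x * a (suc l)) , λ i → begin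
            M i j                            ≈⟨ *-identityˡ _ ⟨
            1# * M i j                       ≈⟨ *-congʳ xa₀≈1 ⟨
            x * a zero * M i j               ≈⟨ *-assoc _ _ _ ⟩
            x * (a zero * M i j)             ≈⟨ *-congˡ (+-inverseˡ-unique _ _ (rel i)) ⟩
            x * - sum (λ l → a (suc l) * M i (f l))
              ≈⟨ -‿distribʳ-* _ _ ⟨
            - (x * sum (λ l → a (suc l) * M i (f l)))
              ≈⟨ -‿distribˡ-* _ _ ⟩
            - x * sum (λ l → a (suc l) * M i (f l))
              ≈⟨ *-distribˡ-sum (- x) (λ l → a (suc l) * M i (f l)) ⟩
            sum (λ l → - x * (a (suc l) * M i (f l)))
              ≈⟨ sum-cong-≋ (λ l → trans (sym (*-assoc (- x) (a (suc l)) (M i (f l)))) (*-comm _ _)) ⟩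
            sum (λ l → M i (f l) * (- x * a (suc l))) ∎)

        coeffs : ∀ l → a l ≈ 0#
        coeffs zero    = a₀≈0
        coeffs (suc l) = li (tail a) (λ i → begin
          sum (λ l → a (suc l) * M i (f l))                  ≈⟨ +-identityˡ _ ⟨
          0# + sum (λ l → a (suc l) * M i (f l))
            ≈⟨ +-congʳ (trans (*-congʳ a₀≈0) (zeroˡ _)) ⟨
          a zero * M i j + sum (λ l → a (suc l) * M i (f l)) ≈⟨ rel i ⟩
          0#                                                 ∎) l

  -- Row `i` of the new left factor is the tensor product of the two old rows `i`; likewise for the
  -- columns of the right factor.
  factors-hadamard : ∀ {m n r s} {M N : Fin m → Fin n → Carrier} →
    FactorsThrough r M → FactorsThrough s N → FactorsThrough (r ℕ.* s) (λ i j → M i j * N i j)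
  factors-hadamard {r = r} {s} {M} {N} (P , Q , M≈PQ) (P′ , Q′ , N≈P′Q′) =
    (λ i → Vector.concat λ k l → P i k * P′ i l) ,
    (λ w j → Vector.concat (λ k l → Q k j * Q′ l j) w) ,
    λ i j → begin
      M i j * N i j
        ≈⟨ *-cong (M≈PQ i j) (N≈P′Q′ i j) ⟩
      sum (λ k → P i k * Q k j) * sum (λ l → P′ i l * Q′ l j)
        ≈⟨ sum-*-sum (λ k → P i k * Q k j) _ ⟩
      sum (Vector.concat λ k l → P i k * Q k j * (P′ i l * Q′ l j))
        -- Every concatenation decodes `w` to the same pair `(k , l)`, so only four scalars are
        -- rearranged.
        ≈⟨ sum-cong-≋ (λ (w : Fin (r ℕ.* s)) → interchange _ _ _ _) ⟩
      sum (λ w → Vector.concat (λ k l → P i k * P′ i l) w * Vector.concat (λ k l → Q k j * Q′ l j) w) ∎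

  -- This matrix is the Kronecker power of `M` with rows and columns selected by `u`. It is an
  -- entrywise product over the coordinates, and selecting rows of `P` and columns of `Q` preserves
  -- the inner dimension.
  factors-product : ∀ {m n r} {M : Matrix n} → FactorsThrough r M →
    ∀ t (u : Fin m → Fin t → Fin n) →
    FactorsThrough (r ℕ.^ t) (λ a b → product λ i → M (u a i) (u b i))
  -- The empty product is the all-ones matrix, which factors through dimension `r ^ 0 = 1`.
  factors-product _ zero u =
    (λ _ _ → 1#) , (λ _ _ → 1#) , λ _ _ → sym (trans (+-identityʳ _) (*-identityʳ 1#))
  factors-product {M = M} fact@(P , Q , M≈PQ) (suc t) u = factors-hadamard
    ((λ a → P (u a zero)) , (λ l b → Q l (u b zero)) , λ a b → M≈PQ (u a zero) (u b zero))
    (factors-product {M = M} fact t (λ a → u a ∘ suc))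

  -- The rows of `P` are `m` independent vectors in dimension `N`: a relation `aP = 0` gives
  -- `aD = aPQ = 0`, whose entry at `b` is `a b * D b b`.
  nonsingular-diagonal⇒≤ : ∀ {m N} (D : Matrix m) → (∀ i j → i ≢ j → D i j ≈ 0#) →
    (∀ i → ¬ (D i i ≈ 0#)) → FactorsThrough N D → m ℕ.≤ N
  nonsingular-diagonal⇒≤ D off diag (P , Q , D≈PQ) = linearlyIndependent⇒≤ P λ a rel b →
    x*y≈0∧y≉0⇒x≈0 (begin
      a b * D b b
        ≈⟨ sum-supported (λ i → a i * D i b) b
             (λ i i≢b → trans (*-congˡ (off i b i≢b)) (zeroʳ _)) ⟨
      sum (λ i → a i * D i b)
        ≈⟨ sum-cong-≋ (λ i → *-congˡ (D≈PQ i b)) ⟩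
      sum (λ i → a i * sum (λ l → P i l * Q l b))
        ≈⟨ sum-cong-≋ (λ i → trans (*-distribˡ-sum (a i) (λ l → P i l * Q l b))
                                   (sum-cong-≋ λ l → sym (*-assoc (a i) (P i l) (Q l b)))) ⟩
      sum (λ i → sum λ l → a i * P i l * Q l b)
        ≈⟨ ∑-comm (λ i l → a i * P i l * Q l b) ⟩
      sum (λ l → sum λ i → a i * P i l * Q l b)
        ≈⟨ sum-≈0 _ (λ l → begin
             sum (λ i → a i * P i l * Q l b)    ≈⟨ *-distribʳ-sum (Q l b) (λ i → a i * P i l) ⟨
             sum (λ i → a i * P i l) * Q l b    ≈⟨ *-congʳ (rel l) ⟩
             0# * Q l b                         ≈⟨ zeroˡ _ ⟩
             0#                                 ∎) ⟩
      0# ∎) (diag b)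

  -- Haemers' bound for a matrix fitting the graph H.
  Θ≤rank : ∀ {n} (H : Graph n) (M : Matrix n) →
    (∀ u v → u ≢ v → ¬ Graph.Adj H u v → M u v ≈ 0#) → (∀ u → ¬ (M u u ≈ 0#)) →
    ∀ {r} → Rank M r → Θ H ≤ℝ fromℕ r
  Θ≤rank {n} H M off diag {r} rank = Θ-least H λ t →
    maxSize-least (isIndependent? (H □^ t)) λ S ind →
      let u : Fin ∣ S ∣ → Fin t → Fin n
          u a = finToFun (enumerate S a) in
      decidable-stable (_ ℕ.≤? _) (¬¬-map (λ fact → nonsingular-diagonal⇒≤ _
        (λ a b a≢b →
          -- At a separating coordinate the entry of `M` vanishes, and with it the whole product.
          let i , uᵢ≢vᵢ , ¬adj = independent-□^-separated H t ind
                (enumerate-∈ S a) (enumerate-∈ S b) (a≢b ∘ enumerate-injective S)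
          in product-≈0 (λ i → M (u a i) (u b i)) i (off _ _ uᵢ≢vᵢ ¬adj))
        (λ a → product-≉0 _ λ i → diag (u a i))
        (factors-product {M = M} fact t u))
        (rank⇒factors M rank))

  -- Entries of matrix polynomials

  -- The entry of `A ^ᴹ m` sums over walks of `m` steps that may also stay in place, since the
  -- diagonal of `A` is free. Dropping the idle steps leaves a walk of length at most `m`.
  ^ᴹ-≈0 : ∀ {n} (G : Graph n) {A : Matrix n} → A ∈𝒜 G →
          ∀ m u v → Dist> G m u v → (A ^ᴹ m) u v ≈ 0#
  ^ᴹ-≈0 G A∈𝒜 zero u v far with u ≟ v
  ... | yes ≡.refl = contradiction (0 , z≤n , nil) far
  ... | no  _      = refl
  ^ᴹ-≈0 G {A} A∈𝒜 (suc m) u v far = sum-≈0 _ term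
    where
    right : ∀ w → Dist> G m w v → A u w * (A ^ᴹ m) w v ≈ 0#
    right w far′ = trans (*-congˡ (^ᴹ-≈0 G A∈𝒜 m w v far′)) (zeroʳ _)

    term : ∀ w → A u w * (A ^ᴹ m) w v ≈ 0#
    term w with u ≟ w | Graph.adj? G u w
    ... | yes ≡.refl | _       = right w λ (l , l≤m , p) → far (l , ℕ.m≤n⇒m≤1+n l≤m , p)
    ... | no _       | yes u~w = right w λ (l , l≤m , p) → far (suc l , s≤s l≤m , cons u~w p)
    ... | no u≢w     | no ¬u~w = trans (*-congʳ (A∈𝒜 u w u≢w ¬u~w)) (zeroˡ _)

  -- The exponents in `p` are at most `k`, so vertices further apart than `k` are further apart than
  -- every exponent.
  ⟦⟧-≈0 : ∀ {n k} (G : Graph n) {A : Matrix n} → A ∈𝒜 G → (p : Poly≤ k) →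
          ∀ u v → Dist> G k u v → (p ⟦ A ⟧) u v ≈ 0#
  ⟦⟧-≈0 G {A} A∈𝒜 p u v far = sum-≈0 (λ m → p m * (A ^ᴹ toℕ m) u v) λ m → trans
    (*-congˡ (^ᴹ-≈0 G A∈𝒜 (toℕ m) u v λ (l , l≤m , w) →
      far (l , ℕ.≤-trans l≤m (toℕ≤pred[n] m) , w)))
    (zeroʳ _)

theorem16 : ∀ {c ℓ₁ ℓ₂} (k : ℕ) .{{_ : NonZero k}} (F : HeytingField c ℓ₁ ℓ₂) →
    let open HeytingField F
        open LinearAlgebra F
    in (n : ℕ) .{{_ : NonZero n}} (G : Graph n) (A : Matrix n) → A ∈𝒜 G →
       (p : Poly≤ k) → (∀ u → ¬ ((p ⟦ A ⟧) u u ≈ 0#)) →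
       (fromℕ (α[ k ] G) ≤ℝ Θ (G ^ᴳ k)) ×
       (∀ r → Rank (p ⟦ A ⟧) r → Θ (G ^ᴳ k) ≤ℝ fromℕ r)
theorem16 k F n G A A∈𝒜 p diag =
  α≤Θ (G ^ᴳ k) (α[k]≤α-^ᴳ k G) ,
  λ r → Θ≤rank (G ^ᴳ k) (p ⟦ A ⟧)
    (λ u v u≢v ¬adj → ⟦⟧-≈0 G A∈𝒜 p u v λ near → ¬adj (u≢v , near)) diag
  where
  open LinearAlgebra F
  open FieldLinearAlgebra F
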